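{- Let $g,n,N$ be positive integers, and let $\mathcal{C}$ be a modular $g$-Golomb ruler with $n$ marks modulo $N$. Write $$n=ag+r,\qquad 0\le r<g,$$ with $a,r$ integers. Then there is an ordinary $g$-Golomb ruler with $n$ marks and diameter at most $$N-\left\lceil \frac{N+\frac{g a(a-1)}2+ra}{n}\right\rceil.$$ The same bound is valid for every larger target multiplicity: for every integer $g'\ge g$ there is an ordinary $g'$-Golomb ruler with $n$ marks and diameter at most the same quantity (computed with the original $g,a,r$).
   Context: A finite set $\mathcal{G}\subset\mathbb{Z}$ is a (ordinary) $g$-Golomb ruler if for every positive integer $d$ the number of pairs $(a,c)\in \mathcal{G}^2$ with $c-a=d$ is at most $g$; its elements are called marks and its diameter is its largest element minus its smallest element. A set $\mathcal{A}$ of residues modulo $N$ is a modular $g$-Golomb ruler modulo $N$ if every nonzero residue modulo $N$ occurs at most $g$ times as a difference $a-a' \pmod N$ with $(a,a')$ an ordered pair of distinct elements of $\mathcal{A}$; its elements are called marks. -}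

module Defs where

open import Data.Fin.Base as Fin using (Fin; toℕ)
import Data.Fin.Properties as Fin
open import Data.Fin.Subset using (Subset; _∈_)
open import Data.Fin.Subset.Properties using (_∈?_)
open import Data.Integer.Base as ℤ using (ℤ; +_; 0ℤ; 1ℤ)
import Data.Integer.Properties as ℤ
open import Data.Integer.DivMod using (_%ℕ_)
open import Data.List.Base using (List; []; _∷_; length; filter; allFin; cartesianProduct)
open import Data.List.Extrema ℤ.≤-totalOrder using (max; min)
open import Data.List.Relation.Unary.Unique.Propositional using (Unique)
open import Data.Nat.Base as ℕ using (ℕ; NonZero)
import Data.Nat.Properties as ℕ
open import Data.Product.Base using (_×_; _,_)
open import Data.Rational.Base as ℚ using (ℚ; ceiling)
open import Relation.Binary.PropositionalEquality.Core using (_≡_; _≢_)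
open import Relation.Nullary.Decidable.Core using (_×-dec_; ¬?)

-- A finite set of integers is given by a duplicate-free list of its elements.

differenceCount : List ℤ → ℤ → ℕ
differenceCount G d =
  length (filter (λ (a , c) → (c ℤ.- a) ℤ.≟ d) (cartesianProduct G G))

IsGolombRuler : ℕ → List ℤ → Set
IsGolombRuler g G = Unique G × (∀ d → 0ℤ ℤ.< d → differenceCount G d ℕ.≤ g)

-- The value at [] is a dummy.
diameter : List ℤ → ℤ
diameter []       = 0ℤ
diameter (x ∷ xs) = max x xs ℤ.- min x xs

-- Residues modulo N are represented by Fin N.  The remainder _%ℕ_ of an
-- integer is always in the range 0 , … , N - 1, also for negative dividends.

module _ (N : ℕ) .{{_ : NonZero N}} where

  modularDifferenceCount : Subset N → Fin N → ℕ
  modularDifferenceCount A d =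
    length (filter (λ (a , a′) → (a ∈? A) ×-dec (a′ ∈? A) ×-dec ¬? (a Fin.≟ a′)
                     ×-dec ((+ toℕ a ℤ.- + toℕ a′) %ℕ N ℕ.≟ toℕ d))
                   (cartesianProduct (allFin N) (allFin N)))

  IsModularGolombRuler : ℕ → Subset N → Set
  IsModularGolombRuler g A =
    ∀ (d : Fin N) → toℕ d ≢ 0 → modularDifferenceCount A d ℕ.≤ g

diameterBound : (g n N : ℕ) .{{_ : NonZero n}} → (a r : ℤ) → ℤ
diameterBound g n N a r = + N ℤ.- ceiling (numerator ℚ.* (1ℤ ℚ./ n))
  where
  numerator : ℚ
  numerator = (+ N ℚ./ 1)
        ℚ.+ ((+ g ℤ.* a ℤ.* (a ℤ.- 1ℤ)) ℚ./ 2)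
        ℚ.+ ((r ℤ.* a) ℚ./ 1)

{-# OPTIONS --safe #-}

-- Cut the circle ℤ/N at a longest arc, of length m, between cyclically
-- consecutive marks; the unrolled marks form a g-Golomb ruler of diameter N − m.
-- Each arc length is the difference of two marks, so every value occurs at
-- most g times among the n defects m − len.  Hence their sum n m − N is at
-- least that of the multiset with g copies each of 0, …, a − 1 and r copies
-- of a, which is g a (a − 1) / 2 + r a.

module Submission where

open import Defs
open import Data.Bool.Base using (true; false)
open import Data.Fin.Base as Fin using (Fin; suc; toℕ; fromℕ<)
import Data.Fin.Properties as Fin
open import Data.Fin.Subset using (Subset; ∣_∣) renaming (_∈_ to _∈ₛ_)
open import Data.Fin.Subset.Properties using (_∈?_; drop-there)
open import Data.Integer.Base as ℤ using (ℤ; +_; -[1+_]; 0ℤ; 1ℤ; -1ℤ; _%ℕ_; _⊖_)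
open import Data.Integer.DivMod using (n<s[n/ℕd]*d; div-pos-is-/ℕ)
import Data.Integer.Properties as ℤ
import Data.Integer.Tactic.RingSolver as ℤ
open import Data.List.Base using (List; []; _∷_; length; map; filter; allFin; tabulate; cartesianProduct; _++_)
open import Data.List.Extrema ℤ.≤-totalOrder using (max≤v⁺; v≤min⁺)
open import Data.List.Membership.Propositional using (_∈_)
open import Data.List.Membership.Propositional.Properties
  using (∈-∃++; ∈-++⁻; ∈-++⁺ˡ; ∈-++⁺ʳ; ∈-filter⁻; ∈-filter⁺; ∈-map⁻; ∈-map⁺; ∈-allFin;
    ∈-cartesianProduct⁺; ∈-cartesianProduct⁻)
open import Data.List.Properties using (length-++; length-filter; length-map; map-tabulate; filter-≐)
open import Data.List.Relation.Binary.Subset.Propositional using (_⊆_)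
open import Data.List.Relation.Unary.All as All using (All; []; _∷_)
import Data.List.Relation.Unary.All.Properties as All
open import Data.List.Relation.Unary.AllPairs as AllPairs using (AllPairs; []; _∷_)
import Data.List.Relation.Unary.AllPairs.Properties as AllPairs
open import Data.List.Relation.Unary.Any using (here; there)
open import Data.List.Relation.Unary.Unique.Propositional using (Unique)
import Data.List.Relation.Unary.Unique.Propositional.Properties as Unique
open import Data.Nat.Base as ℕ
open import Data.Nat.DivMod using (m<n⇒m%n≡m)
open import Data.Nat.ListAction using (sum)
open import Data.Nat.Properties
open import Data.List.Extrema ≤-totalOrder using (argmax; argmax-sel; f[⊥]≤f[argmax]; f[xs]≤f[argmax])
open import Data.Nat.Tactic.RingSolver using (solve-∀)
open import Data.Product.Base using (_×_; _,_; ∃-syntax; proj₂)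
open import Data.Rational.Base as ℚ using (ceiling; toℚᵘ)
import Data.Rational.Properties as ℚ
open import Data.Rational.Unnormalised.Base as ℚᵘ using (mkℚᵘ)
import Data.Rational.Unnormalised.Properties as ℚᵘ
open import Data.Sum.Base using (_⊎_; inj₁; inj₂)
open import Data.Vec.Base using ([]; _∷_) renaming (there to thereₛ)
open import Function.Base using (_∘_; id)
open import Level using (Level)
open import Relation.Binary.PropositionalEquality
open import Relation.Nullary using (Dec; yes; no; contradiction)
open import Relation.Nullary.Decidable using (does; _×-dec_; ¬?)
open import Relation.Unary using (Pred; Decidable)

private variable
  ℓ₁ ℓ₂ ℓ₃ : Level
  A : Set ℓ₁
  B : Set ℓ₂

-- Counting with duplicate-free lists and subsets.

-- Pigeonhole by deletion: removing one occurrence of the head from `ys` still leaves the tail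
-- inside the remainder, because the tail does not contain the head.
Unique-⊆⇒length≤ : {xs ys : List A} → Unique xs → xs ⊆ ys → length xs ≤ length ys
Unique-⊆⇒length≤ [] _ = z≤n
Unique-⊆⇒length≤ {xs = x ∷ xs} (x≢xs ∷ xs!) x∷xs⊆ys with ∈-∃++ (x∷xs⊆ys (here refl))
... | us , vs , refl = begin
  suc (length xs)                ≤⟨ s≤s (Unique-⊆⇒length≤ xs! xs⊆us++vs) ⟩
  suc (length (us ++ vs))        ≡⟨ cong suc (length-++ us) ⟩
  suc (length us + length vs)    ≡⟨ +-suc (length us) (length vs) ⟨
  length us + length (x ∷ vs)    ≡⟨ length-++ us ⟨
  length (us ++ x ∷ vs)          ∎
  where
  open ≤-Reasoning
  xs⊆us++vs : xs ⊆ us ++ vs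
  xs⊆us++vs z∈xs with ∈-++⁻ us (x∷xs⊆ys (there z∈xs))
  ... | inj₁ z∈us         = ∈-++⁺ˡ z∈us
  ... | inj₂ (here refl)  = contradiction refl (All.lookup x≢xs z∈xs)
  ... | inj₂ (there z∈vs) = ∈-++⁺ʳ us z∈vs

length-filter-map : {P : Pred B ℓ₃} (P? : Decidable P) (f : A → B) (xs : List A) →
  length (filter P? (map f xs)) ≡ length (filter (P? ∘ f) xs)
length-filter-map P? f []       = refl
length-filter-map P? f (x ∷ xs) with does (P? (f x))
... | true  = cong suc (length-filter-map P? f xs)
... | false = length-filter-map P? f xs

elements : ∀ {n} → Subset n → List (Fin n)
elements {n} p = filter (_∈? p) (allFin n)

-- The tail of `allFin (suc n)` is `tabulate suc`, so it has to be reindexed by `suc` before the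
-- count for `p` applies.
length-elements-∷ : ∀ {n s} (p : Subset n) →
  length (filter (_∈? (s ∷ p)) (tabulate suc)) ≡ ∣ p ∣
length-elements : ∀ {n} (p : Subset n) → length (elements p) ≡ ∣ p ∣

length-elements []      = refl
length-elements {suc n} (s ∷ p) with s
... | true  = cong suc (length-elements-∷ p)
... | false = length-elements-∷ p

length-elements-∷ {n} {s} p = begin
  length (filter (_∈? (s ∷ p)) (tabulate suc))          ≡⟨ cong (length ∘ filter (_∈? (s ∷ p))) (map-tabulate id suc) ⟨
  length (filter (_∈? (s ∷ p)) (map suc (allFin n)))    ≡⟨ length-filter-map (_∈? (s ∷ p)) suc (allFin n) ⟩
  length (filter (λ i → suc i ∈? (s ∷ p)) (allFin n))   ≡⟨ cong length (filter-≐ (λ i → suc i ∈? (s ∷ p)) (_∈? p)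
                                                             (drop-there , thereₛ) (allFin n)) ⟩
  length (elements p)                                   ≡⟨ length-elements p ⟩
  ∣ p ∣                                                 ∎
  where open ≡-Reasoning

-- The least sum of natural numbers with bounded multiplicities.

count : ℕ → List ℕ → ℕ
count k xs = length (filter (_≟ k) xs)

-- The inductive step of the sum bound. If all multiplicities are at most `g`, dropping the zeros
-- costs at most `g` entries; lowering the others by one turns the multiplicity of `suc k` into that
-- of `k`, so the hypothesis survives.
descend : List ℕ → List ℕ
descend []           = []
descend (zero  ∷ xs) = descend xs
descend (suc x ∷ xs) = x ∷ descend xs

count-descend : ∀ k xs → count k (descend xs) ≡ count (suc k) xs
count-descend k []           = refl
count-descend k (zero  ∷ xs) = count-descend k xs
count-descend k (suc x ∷ xs) with does (x ≟ k)
... | true  = cong suc (count-descend k xs)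
... | false = count-descend k xs

sum-descend : ∀ xs → sum xs ≡ sum (descend xs) + length (descend xs)
sum-descend []           = refl
sum-descend (zero  ∷ xs) = sum-descend xs
sum-descend (suc x ∷ xs) = begin
  suc (x + sum xs)                                       ≡⟨ cong (λ s → suc (x + s)) (sum-descend xs) ⟩
  suc (x + (sum (descend xs) + length (descend xs)))     ≡⟨ cong suc (+-assoc x _ _) ⟨
  suc (x + sum (descend xs) + length (descend xs))       ≡⟨ +-suc _ _ ⟨
  x + sum (descend xs) + suc (length (descend xs))       ∎
  where open ≡-Reasoning

length-descend : ∀ xs → length xs ≡ length (descend xs) + count 0 xs
length-descend []           = refl
length-descend (zero  ∷ xs) = trans (cong suc (length-descend xs)) (sym (+-suc _ _))
length-descend (suc x ∷ xs) = cong suc (length-descend xs)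

-- Doubled, and with g k (k + 1) moved to the right, so that no subtraction or halving occurs.
sum-lower-bound : ∀ {g} k xs → (∀ v → count v xs ≤ g) →
  2 * (length xs * k) ≤ 2 * sum xs + g * (k * suc k)
sum-lower-bound {g} zero xs h = begin
  2 * (length xs * 0)  ≡⟨ cong (2 *_) (*-zeroʳ (length xs)) ⟩
  0                    ≤⟨ z≤n ⟩
  _                    ∎
  where open ≤-Reasoning
sum-lower-bound {g} (suc k) xs h = begin
  2 * (length xs * suc k)                               ≡⟨ cong (λ l → 2 * (l * suc k)) (length-descend xs) ⟩
  2 * ((l + count 0 xs) * suc k)                        ≤⟨ *-monoʳ-≤ 2 (*-monoˡ-≤ (suc k) (+-monoʳ-≤ l (h 0))) ⟩
  2 * ((l + g) * suc k)                                 ≡⟨ eq₁ l g k ⟩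
  2 * (l * k) + 2 * (l + g * suc k)                     ≤⟨ +-monoˡ-≤ _ (sum-lower-bound k ys
                                                             (λ v → subst (_≤ g) (sym (count-descend v xs)) (h (suc v)))) ⟩
  2 * sum ys + g * (k * suc k) + 2 * (l + g * suc k)    ≡⟨ eq₂ (sum ys) l g k ⟩
  2 * (sum ys + l) + g * (suc k * suc (suc k))          ≡⟨ cong (λ s → 2 * s + g * (suc k * suc (suc k))) (sum-descend xs) ⟨
  2 * sum xs + g * (suc k * suc (suc k))                ∎
  where
  open ≤-Reasoning
  ys = descend xs
  l = length ys
  eq₁ : ∀ l g k → 2 * ((l + g) * suc k) ≡ 2 * (l * k) + 2 * (l + g * suc k)
  eq₁ = solve-∀
  eq₂ : ∀ s l g k → 2 * s + g * (k * suc k) + 2 * (l + g * suc k) ≡ 2 * (s + l) + g * (suc k * suc (suc k))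
  eq₂ = solve-∀

-- Deficits, maxima, diameters and the increasing list of a subset.

sum-deficit : ∀ {m} (f : A → ℕ) {xs} → All (λ x → f x ≤ m) xs →
  sum (map (λ x → m ∸ f x) xs) + sum (map f xs) ≡ length xs * m
sum-deficit f []                           = refl
sum-deficit {m = m} f {x ∷ xs} (fx≤m ∷ fxs≤m) = trans
  (+-interchange (m ∸ f x) (sum (map (λ y → m ∸ f y) xs)) (f x) (sum (map f xs)))
  (cong₂ _+_ (m∸n+n≡m fx≤m) (sum-deficit f fxs≤m))
  where
  +-interchange : ∀ a b c d → a + b + (c + d) ≡ a + c + (b + d)
  +-interchange = solve-∀

∃-maximum : (f : A → ℕ) (xs : List A) → 0 < length xs →
  ∃[ y ] y ∈ xs × All (λ z → f z ≤ f y) xs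
∃-maximum f (x ∷ xs) _ with argmax-sel f x xs
... | inj₁ eq  = argmax f x xs , here eq , f[⊥]≤f[argmax] {f = f} x xs ∷ f[xs]≤f[argmax] {f = f} x xs
... | inj₂ ∈xs = argmax f x xs , there ∈xs , f[⊥]≤f[argmax] {f = f} x xs ∷ f[xs]≤f[argmax] {f = f} x xs

diameter-≤ : ∀ {lo hi x xs} → All (lo ℤ.≤_) (x ∷ xs) → All (ℤ._≤ hi) (x ∷ xs) →
  diameter (x ∷ xs) ℤ.≤ hi ℤ.- lo
diameter-≤ (lo≤x ∷ lo≤xs) (x≤hi ∷ xs≤hi) =
  ℤ.+-mono-≤ (max≤v⁺ x≤hi xs≤hi) (ℤ.neg-mono-≤ (v≤min⁺ lo≤x lo≤xs))

elements-nonempty : ∀ {n} (p : Subset n) → ∣ p ∣ ≢ 0 → ∃[ x ] ∃[ xs ] elements p ≡ x ∷ xs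
elements-nonempty p ∣p∣≢0 with elements p | length-elements p
... | []     | 0≡∣p∣ = contradiction (sym 0≡∣p∣) ∣p∣≢0
... | x ∷ xs | _     = x , xs , refl

elements-sorted : ∀ {n} (p : Subset n) → AllPairs Fin._<_ (elements p)
elements-sorted p = AllPairs.filter⁺ (_∈? p) (AllPairs.tabulate⁺-< id)

∈-elements⁻ : ∀ {n} {p : Subset n} {i} → i ∈ elements p → i ∈ₛ p
∈-elements⁻ {n} {p} i∈ = proj₂ (∈-filter⁻ (_∈? p) {xs = allFin n} i∈)

+-swapʳ : ∀ m n o → m + n + o ≡ m + o + n
+-swapʳ = solve-∀

m+[o∸n]≤o : ∀ {m n o} → m ≤ n → n ≤ o → m + (o ∸ n) ≤ o
m+[o∸n]≤o {m} {n} {o} m≤n n≤o = ≤-trans (+-monoˡ-≤ (o ∸ n) m≤n) (≤-reflexive (m+[n∸m]≡n n≤o))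

-- Differences modulo `N` and the unrolled circle.

module _ {N : ℕ} where

  -- The congruence u - w ≡ v modulo `N`, for a representative `v` of a nonzero residue, written
  -- without subtraction. Since `toℕ w + v` is below 2N, only the two listed equations can occur.
  record IsDifference (u w : Fin N) (v : ℕ) : Set where
    constructor isDifference
    field
      positive  : 0 < v
      bounded   : v < N
      congruent : toℕ w + v ≡ toℕ u ⊎ toℕ w + v ≡ toℕ u + N

  IsDifference⇒≢ : ∀ {u w v} → IsDifference u w v → u ≢ w
  IsDifference⇒≢ {u} (isDifference 0<v v<N (inj₁ eq)) refl = <⇒≢ (m<m+n (toℕ u) 0<v) (sym eq)
  IsDifference⇒≢ {u} (isDifference 0<v v<N (inj₂ eq)) refl = <⇒≢ v<N (+-cancelˡ-≡ (toℕ u) _ _ eq)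

  ∸-IsDifference : ∀ {x y} → x Fin.< y → IsDifference y x (toℕ y ∸ toℕ x)
  ∸-IsDifference {x} {y} x<y = isDifference (m<n⇒0<n∸m x<y)
    (≤-<-trans (m∸n≤m (toℕ y) (toℕ x)) (Fin.toℕ<n y)) (inj₁ (m+[n∸m]≡n (<⇒≤ x<y)))

  -- Unrolls ℤ/N onto the window q, …, q + N − 1.
  lift : Fin N → Fin N → ℕ
  lift q c with toℕ q ≤? toℕ c
  ... | yes _ = toℕ c
  ... | no  _ = toℕ c + N

  lift-spec : ∀ q c → (toℕ q ≤ toℕ c × lift q c ≡ toℕ c) ⊎ (toℕ c < toℕ q × lift q c ≡ toℕ c + N)
  lift-spec q c with toℕ q ≤? toℕ c
  ... | yes q≤c = inj₁ (q≤c , refl)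
  ... | no  q≰c = inj₂ (≰⇒> q≰c , refl)

  q≤lift : ∀ q c → toℕ q ≤ lift q c
  q≤lift q c with lift-spec q c
  ... | inj₁ (q≤c , eq) rewrite eq = q≤c
  ... | inj₂ (c<q , eq) rewrite eq = ≤-trans (<⇒≤ (Fin.toℕ<n q)) (m≤n+m N (toℕ c))

  <N⇒≢+N : ∀ (u : Fin N) k → toℕ u ≢ k + N
  <N⇒≢+N u k = <⇒≢ (<-≤-trans (Fin.toℕ<n u) (m≤n+m N k))

  lift-injective : ∀ q {c c′} → lift q c ≡ lift q c′ → c ≡ c′
  lift-injective q {c} {c′} eq with lift-spec q c | lift-spec q c′
  ... | inj₁ (_ , e) | inj₁ (_ , e′) = Fin.toℕ-injective (trans (sym e) (trans eq e′))
  ... | inj₁ (_ , e) | inj₂ (_ , e′) = contradiction (trans (sym e) (trans eq e′)) (<N⇒≢+N c _)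
  ... | inj₂ (_ , e) | inj₁ (_ , e′) = contradiction (trans (sym e′) (trans (sym eq) e)) (<N⇒≢+N c′ _)
  ... | inj₂ (_ , e) | inj₂ (_ , e′) =
    Fin.toℕ-injective (+-cancelʳ-≡ N _ _ (trans (sym e) (trans eq e′)))

  -- Both lifts lie in one window of `N` consecutive integers, so their distance is below `N`. The
  -- cases record which marks were shifted by `N`; a shifted `w` below an unshifted `u` is
  -- impossible, since shifted lifts are at least `N`.
  lift-difference : ∀ q {u w v} → 0 < v → lift q w + v ≡ lift q u → IsDifference u w v
  lift-difference q {u} {w} {v} 0<v eq with lift-spec q w | lift-spec q u
  ... | inj₁ (q≤w , e) | inj₁ (q≤u , e′) rewrite e | e′ =
    isDifference 0<v (≤-<-trans (m+n≤o⇒n≤o (toℕ w) (≤-reflexive eq)) (Fin.toℕ<n u)) (inj₁ eq)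
  ... | inj₁ (q≤w , e) | inj₂ (u<q , e′) rewrite e | e′ =
    isDifference 0<v (+-cancelˡ-< (toℕ u) v N
      (<-≤-trans (+-monoˡ-< v (<-≤-trans u<q q≤w)) (≤-reflexive eq))) (inj₂ eq)
  ... | inj₂ (w<q , e) | inj₁ (q≤u , e′) rewrite e | e′ =
    contradiction (trans (sym eq) (+-swapʳ (toℕ w) N v)) (<N⇒≢+N u _)
  ... | inj₂ (w<q , e) | inj₂ (u<q , e′) rewrite e | e′ =
    isDifference 0<v (≤-<-trans (m+n≤o⇒n≤o (toℕ w) (≤-reflexive w+v≡u)) (Fin.toℕ<n u)) (inj₁ w+v≡u)
    where
    w+v≡u : toℕ w + v ≡ toℕ u
    w+v≡u = +-cancelʳ-≡ N _ _ (trans (+-swapʳ (toℕ w) v N) eq)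

  -- Arcs between cyclically consecutive marks.

  -- The components are the initial mark, the terminal mark and the length.
  Arc : Set
  Arc = Fin N × Fin N × ℕ

  start : Arc → Fin N
  start (p , _ , _) = p

  len : Arc → ℕ
  len (_ , _ , d) = d

  -- The list x ∷ xs is increasing with z ≤ x, so only the closing arc winds past 0.
  arcs : Fin N → Fin N → List (Fin N) → List Arc
  arcs z x []       = (x , z , toℕ z + N ∸ toℕ x) ∷ []
  arcs z x (y ∷ ys) = (x , y , toℕ y ∸ toℕ x) ∷ arcs z y ys

  -- Each mark starts exactly one arc. Both the number of arcs and their distinctness are read off
  -- from this.
  map-start-arcs : ∀ z x xs → map start (arcs z x xs) ≡ x ∷ xs
  map-start-arcs z x []       = refl
  map-start-arcs z x (y ∷ ys) = cong (x ∷_) (map-start-arcs z y ys)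

  length-arcs : ∀ z x xs → length (arcs z x xs) ≡ length (x ∷ xs)
  length-arcs z x xs = trans (sym (length-map start (arcs z x xs))) (cong length (map-start-arcs z x xs))

  arcs-unique : ∀ z {x xs} → AllPairs Fin._<_ (x ∷ xs) → Unique (arcs z x xs)
  arcs-unique z {x} {xs} x∷xs↗ = Unique.map⁻ {f = start}
    (subst Unique (sym (map-start-arcs z x xs)) (AllPairs.map Fin.<⇒≢ x∷xs↗))

  -- Telescoping. For `x` equal to `z` the total is one full turn, `N`.
  sum-arcs : ∀ z {x xs} → AllPairs Fin._<_ (x ∷ xs) →
    sum (map len (arcs z x xs)) + toℕ x ≡ toℕ z + N
  sum-arcs z {x} {[]} _ rewrite +-identityʳ (toℕ z + N ∸ toℕ x) =
    m∸n+n≡m (≤-trans (<⇒≤ (Fin.toℕ<n x)) (m≤n+m N (toℕ z)))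
  sum-arcs z {x} {y ∷ ys} ((x<y ∷ _) ∷ ys↗) = begin
    toℕ y ∸ toℕ x + S + toℕ x     ≡⟨ swap (toℕ y ∸ toℕ x) S (toℕ x) ⟩
    S + (toℕ y ∸ toℕ x + toℕ x)   ≡⟨ cong (λ k → S + k) (m∸n+n≡m (<⇒≤ x<y)) ⟩
    S + toℕ y                     ≡⟨ sum-arcs z ys↗ ⟩
    toℕ z + N                     ∎
    where
    open ≡-Reasoning
    S = sum (map len (arcs z y ys))
    swap : ∀ a b c → a + b + c ≡ b + (a + c)
    swap = solve-∀

  arc-ends : ∀ {z x xs p q d} → (p , q , d) ∈ arcs z x xs →
    p ∈ x ∷ xs × (q ≡ z ⊎ q ∈ xs)
  arc-ends {xs = []}     (here refl) = here refl , inj₁ refl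
  arc-ends {xs = y ∷ ys} (here refl) = here refl , inj₂ (here refl)
  arc-ends {xs = y ∷ ys} (there pqd∈) with arc-ends pqd∈
  ... | p∈ , inj₁ q≡z  = there p∈ , inj₁ q≡z
  ... | p∈ , inj₂ q∈ys = there p∈ , inj₂ (there q∈ys)

  -- Inner arcs are plain differences. The closing arc passes 0 once, which is the `+ N` case, and
  -- the strict inequality between `z` and `x` keeps it shorter than `N`.
  arc-difference : ∀ {z x xs p q d} → AllPairs Fin._<_ (x ∷ xs) → z Fin.< x →
    (p , q , d) ∈ arcs z x xs → IsDifference q p d
  arc-difference {z} {x} {[]} _ z<x (here refl) = isDifference
    (m<n⇒0<n∸m (<-≤-trans (Fin.toℕ<n x) (m≤n+m N (toℕ z))))
    (+-cancelˡ-< (toℕ z) _ N (<-≤-trans (+-monoˡ-< _ z<x) (≤-reflexive eq)))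
    (inj₂ eq)
    where
    eq : toℕ x + (toℕ z + N ∸ toℕ x) ≡ toℕ z + N
    eq = m+[n∸m]≡n (≤-trans (<⇒≤ (Fin.toℕ<n x)) (m≤n+m N (toℕ z)))
  arc-difference {xs = y ∷ ys} (x<y∷ys ∷ _) z<x (here refl) = ∸-IsDifference (All.head x<y∷ys)
  arc-difference {xs = y ∷ ys} ((x<y ∷ _) ∷ ys↗) z<x (there pqd∈) =
    arc-difference ys↗ (<-trans z<x x<y) pqd∈

  -- In the window starting at `q`, the arc that ends at `q` occupies the last `d` places before
  -- `q + N`. No mark lies in its interior, so every lift stays at or below its start. Marks passed
  -- during the recursion are absorbed into the alternative `c ≤ x`.
  lift-clears-arc : ∀ {z x xs p q d} → AllPairs Fin._<_ (x ∷ xs) →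
    (p , q , d) ∈ arcs z x xs → ∀ {c} → z Fin.≤ c → c Fin.≤ x ⊎ c ∈ xs →
    lift q c + d ≤ toℕ q + N
  lift-clears-arc {z} {x} {[]} _ (here refl) {c} z≤c (inj₁ c≤x) with lift-spec z c
  ... | inj₁ (_ , eq) rewrite eq = m+[o∸n]≤o c≤x (≤-trans (<⇒≤ (Fin.toℕ<n x)) (m≤n+m N (toℕ z)))
  ... | inj₂ (c<z , _) = contradiction z≤c (<⇒≱ c<z)
  lift-clears-arc {z} {x} {y ∷ ys} ((x<y ∷ _) ∷ y<ys ∷ _) (here refl) {c} z≤c c∈ with lift-spec y c
  -- An unshifted mark is below `N`, and the arc has length at most `toℕ y`; adding these two
  -- estimates suffices.
  ... | inj₁ (y≤c , eq) rewrite eq | +-comm (toℕ y) N =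
    +-mono-≤ (<⇒≤ (Fin.toℕ<n c)) (m∸n≤m (toℕ y) (toℕ x))
  ... | inj₂ (c<y , eq) rewrite eq = begin
    toℕ c + N + (toℕ y ∸ toℕ x)    ≡⟨ +-swapʳ (toℕ c) N (toℕ y ∸ toℕ x) ⟩
    toℕ c + (toℕ y ∸ toℕ x) + N    ≤⟨ +-monoˡ-≤ N (m+[o∸n]≤o (c≤x c∈) (<⇒≤ x<y)) ⟩
    toℕ y + N                      ∎
    where
    open ≤-Reasoning
    -- Consecutiveness of `x` and `y` enters here: a mark below `y` is at most `x`.
    c≤x : c Fin.≤ x ⊎ c ∈ y ∷ ys → c Fin.≤ x
    c≤x (inj₁ c≤x)          = c≤x
    c≤x (inj₂ (here refl))  = contradiction c<y (n≮n _)
    c≤x (inj₂ (there c∈ys)) = contradiction c<y (<⇒≯ (All.lookup y<ys c∈ys))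
  lift-clears-arc {x = x} {y ∷ ys} ((x<y ∷ _) ∷ ys↗) (there pqd∈) z≤c c∈ =
    lift-clears-arc ys↗ pqd∈ z≤c (c≤y⊎c∈ys c∈)
    where
    c≤y⊎c∈ys : ∀ {c} → c Fin.≤ x ⊎ c ∈ y ∷ ys → c Fin.≤ y ⊎ c ∈ ys
    c≤y⊎c∈ys (inj₁ c≤x)          = inj₁ (≤-trans c≤x (<⇒≤ x<y))
    c≤y⊎c∈ys (inj₂ (here refl))  = inj₁ ≤-refl
    c≤y⊎c∈ys (inj₂ (there c∈ys)) = inj₂ c∈ys

-- Remainders of integer differences.

-- As `v` is positive, `suc t` is below `N` and is its own nonzero remainder; the remainder of the
-- negative number is then `N ∸ suc t`.
-[1+]%ℕ : ∀ {N t v} .{{_ : NonZero N}} → 0 < v → v + suc t ≡ N → -[1+ t ] %ℕ N ≡ v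
-[1+]%ℕ {N} {t} {v} 0<v eq
  rewrite m<n⇒m%n≡m (subst (suc t <_) eq (m<n+m (suc t) 0<v)) | sym eq = m+n∸n≡m v (suc t)

module _ {N : ℕ} .{{_ : NonZero N}} where

  -- Links the subtraction-free form to the remainder in `modularDifferenceCount`. In the second
  -- case `u` is below `w`, so the integer difference is negative and its remainder is `N` minus the
  -- gap.
  IsDifference⇒%ℕ : ∀ {u w v} → IsDifference u w v → (+ toℕ u ℤ.- + toℕ w) %ℕ N ≡ v
  IsDifference⇒%ℕ {u} {w} {v} (isDifference 0<v v<N (inj₁ w+v≡u))
    rewrite ℤ.m-n≡m⊖n (toℕ u) (toℕ w) | sym w+v≡u | ℤ.⊖-≥ (m≤m+n (toℕ w) v) | m+n∸m≡n (toℕ w) v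
    = m<n⇒m%n≡m v<N
  IsDifference⇒%ℕ {u} {w} {v} (isDifference 0<v v<N (inj₂ w+v≡u+N)) = begin
    (+ toℕ u ℤ.- + toℕ w) %ℕ N    ≡⟨ cong (_%ℕ N) u-w≡-[1+t] ⟩
    -[1+ t ] %ℕ N                 ≡⟨ -[1+]%ℕ 0<v v+1+t≡N ⟩
    v                             ∎
    where
    open ≡-Reasoning
    u<w : toℕ u < toℕ w
    u<w = +-cancelʳ-< N (toℕ u) (toℕ w) (≤-<-trans (≤-reflexive (sym w+v≡u+N)) (+-monoʳ-< (toℕ w) v<N))
    t = toℕ w ∸ suc (toℕ u)
    u+1+t≡w : toℕ u + suc t ≡ toℕ w
    u+1+t≡w = trans (+-suc (toℕ u) t) (m+[n∸m]≡n u<w)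
    u-w≡-[1+t] : + toℕ u ℤ.- + toℕ w ≡ -[1+ t ]
    u-w≡-[1+t] = begin
      + toℕ u ℤ.- + toℕ w            ≡⟨ ℤ.m-n≡m⊖n (toℕ u) (toℕ w) ⟩
      toℕ u ⊖ toℕ w                  ≡⟨ ℤ.⊖-< u<w ⟩
      ℤ.- + (toℕ w ∸ toℕ u)          ≡⟨ cong (λ k → ℤ.- + (k ∸ toℕ u)) u+1+t≡w ⟨
      ℤ.- + (toℕ u + suc t ∸ toℕ u)  ≡⟨ cong (λ k → ℤ.- + k) (m+n∸m≡n (toℕ u) (suc t)) ⟩
      -[1+ t ]                       ∎
    v+1+t≡N : v + suc t ≡ N
    v+1+t≡N = +-cancelˡ-≡ (toℕ u) _ _ (begin
      toℕ u + (v + suc t)   ≡⟨ swap (toℕ u) v (suc t) ⟩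
      toℕ u + suc t + v     ≡⟨ cong (_+ v) u+1+t≡w ⟩
      toℕ w + v             ≡⟨ w+v≡u+N ⟩
      toℕ u + N             ∎)
      where
      swap : ∀ a b c → a + (b + c) ≡ a + c + b
      swap = solve-∀

  -- Consequences of the modular Golomb property.

  module _ {g : ℕ} {C : Subset N} (golomb : IsModularGolombRuler N g C) where

    -- The list sits inside the image under `h` of the pairs counted modularly for `v`. Keeping `h`
    -- general lets one pigeonhole argument serve both pairs of lifted marks and arcs of equal
    -- length.
    length≤g : ∀ v (h : Fin N × Fin N → A) {xs} → Unique xs →
      (∀ {x} → x ∈ xs → ∃[ u ] ∃[ w ] x ≡ h (u , w) × u ∈ₛ C × w ∈ₛ C × IsDifference u w v) →
      length xs ≤ g
    length≤g v h {[]}         _   _ = z≤n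
    -- Any member of the list certifies that `v` lies strictly between 0 and `N`, hence names a
    -- nonzero residue to which `golomb` applies.
    length≤g v h {xs@(_ ∷ _)} xs! differ with differ (here refl)
    ... | _ , _ , _ , _ , _ , isDifference 0<v v<N _ = begin
      length xs                       ≤⟨ Unique-⊆⇒length≤ xs! xs⊆ ⟩
      length (map h pairs)            ≡⟨ length-map h pairs ⟩
      modularDifferenceCount N C d    ≤⟨ golomb d (λ eq → <⇒≢ 0<v (trans (sym eq) toℕd≡v)) ⟩
      g                               ∎
      where
      open ≤-Reasoning
      d = fromℕ< v<N
      toℕd≡v = Fin.toℕ-fromℕ< v<N
      P? : (p : Fin N × Fin N) → Dec _
      P? (a , a′) = a ∈? C ×-dec a′ ∈? C ×-dec ¬? (a Fin.≟ a′)
        ×-dec ((+ toℕ a ℤ.- + toℕ a′) %ℕ N ≟ toℕ d)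
      pairs = filter P? (cartesianProduct (allFin N) (allFin N))
      xs⊆ : xs ⊆ map h pairs
      xs⊆ x∈xs with differ x∈xs
      ... | u , w , refl , u∈C , w∈C , v≡u-w = ∈-map⁺ h (∈-filter⁺ P?
        (∈-cartesianProduct⁺ (∈-allFin u) (∈-allFin w))
        (u∈C , w∈C , IsDifference⇒≢ v≡u-w , trans (IsDifference⇒%ℕ v≡u-w) (sym toℕd≡v)))

    -- By `lift-difference`, pairs of lifts at a given positive distance come from pairs of marks
    -- with that modular difference.
    lift-golomb : ∀ q → IsGolombRuler g (map (λ c → + lift q c) (elements C))
    lift-golomb q = G! , count≤g
      where
      f : Fin N → ℤ
      f c = + lift q c
      G = map f (elements C)
      G! : Unique G
      G! = Unique.map⁺ (lift-injective q ∘ ℤ.+-injective)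
        (AllPairs.map Fin.<⇒≢ (elements-sorted C))
      j+[i-j]≡i : ∀ i j → j ℤ.+ (i ℤ.- j) ≡ i
      j+[i-j]≡i = ℤ.solve-∀
      count≤g : ∀ d → 0ℤ ℤ.< d → differenceCount G d ≤ g
      -- The order is reversed: a ruler pair `(a , c)` is counted by c - a, a modular pair `(u , w)`
      -- by u - w.
      count≤g (+ v) (ℤ.+<+ 0<v) = length≤g v (λ (u , w) → f w , f u)
        (Unique.filter⁺ P? (Unique.cartesianProduct⁺ G! G!)) differ
        where
        P? : (p : ℤ × ℤ) → Dec _
        P? (a , c) = (c ℤ.- a) ℤ.≟ + v
        differ : ∀ {x} → x ∈ filter P? (cartesianProduct G G) → _
        differ x∈ with ∈-filter⁻ P? {xs = cartesianProduct G G} x∈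
        ... | x∈G×G , eq with ∈-cartesianProduct⁻ G G x∈G×G
        ... | a∈G , c∈G with ∈-map⁻ f a∈G | ∈-map⁻ f c∈G
        ... | w , w∈ , refl | u , u∈ , refl =
          u , w , refl , ∈-elements⁻ u∈ , ∈-elements⁻ w∈ , lift-difference q 0<v
            (ℤ.+-injective (trans (cong (λ i → f w ℤ.+ i) (sym eq)) (j+[i-j]≡i (f u) (f w))))

    module _ .{{_ : NonZero g}} where

      -- Since no length exceeds `m`, defect `v` forces length `m ∸ v`. Arcs of that length are
      -- determined by their ends, which with two or more marks form a pair of marks with modular
      -- difference `m ∸ v`.
      arc-lengths-bounded : ∀ {z zs m} → elements C ≡ z ∷ zs →
        All (λ x → len x ≤ m) (arcs z z zs) →
        ∀ v → count v (map (λ x → m ∸ len x) (arcs z z zs)) ≤ g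
      arc-lengths-bounded {z} {zs} {m} C≡ len≤m v =
        ≤-trans (≤-reflexive (length-filter-map (_≟ v) (λ x → m ∸ len x) (arcs z z zs))) (bound zs C≡ len≤m)
        where
        bound : ∀ zs → elements C ≡ z ∷ zs → All (λ x → len x ≤ m) (arcs z z zs) →
          length (filter (λ x → m ∸ len x ≟ v) (arcs z z zs)) ≤ g
        -- The only arc of a single mark has length N, which is not a nonzero residue.
        bound []       _  _ = ≤-trans (length-filter (λ x → m ∸ len x ≟ v) (arcs z z [])) (>-nonZero⁻¹ g)
        bound (y ∷ ys) C≡ len≤m = length≤g (m ∸ v) (λ (u , w) → w , u , m ∸ v)
          (Unique.filter⁺ (λ x → m ∸ len x ≟ v) (arcs-unique z zs↗)) differ
          where
          zs↗ : AllPairs Fin._<_ (z ∷ y ∷ ys)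
          zs↗ = subst (AllPairs Fin._<_) C≡ (elements-sorted C)
          ∈C : ∀ {c} → c ∈ z ∷ y ∷ ys → c ∈ₛ C
          ∈C c∈ = ∈-elements⁻ (subst (_ ∈_) (sym C≡) c∈)
          difference : ∀ {p q d} → (p , q , d) ∈ arcs z z (y ∷ ys) → IsDifference q p d
          -- The first arc starts at `z` itself, where the strict inequality required by
          -- `arc-difference` fails; it is a difference that does not wind.
          difference (here refl) = ∸-IsDifference (All.head (AllPairs.head zs↗))
          difference (there pqd∈) = arc-difference (AllPairs.tail zs↗) (All.head (AllPairs.head zs↗)) pqd∈
          differ : ∀ {x} → x ∈ filter (λ x → m ∸ len x ≟ v) (arcs z z (y ∷ ys)) → _
          differ {p , q , d} x∈ with ∈-filter⁻ (λ x → m ∸ len x ≟ v) {xs = arcs z z (y ∷ ys)} x∈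
          ... | x∈arcs , refl with arc-ends x∈arcs | sym (m∸[m∸n]≡n (All.lookup len≤m x∈arcs))
          ... | p∈ , q∈ | d≡ = q , p , cong (λ d → p , q , d) d≡ , ∈C (q∈C q∈) , ∈C p∈ ,
            subst (IsDifference q p) d≡ (difference x∈arcs)
            where
            q∈C : q ≡ z ⊎ q ∈ y ∷ ys → q ∈ z ∷ y ∷ ys
            q∈C (inj₁ refl) = here refl
            q∈C (inj₂ q∈)   = there q∈

      -- The inequality is the sum bound for the defects, whose total is `∣ C ∣ * m` minus `N`. It
      -- holds for every `k`; the quotient `a` is the value used in the end.
      golomb-ruler : ∣ C ∣ ≢ 0 → ∃[ G ] ∃[ m ] IsGolombRuler g G × length G ≡ ∣ C ∣ ×
        diameter G ℤ.≤ + N ℤ.- + m ×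
        (∀ k → 2 * (∣ C ∣ * k) + 2 * N ≤ 2 * (∣ C ∣ * m) + g * (k * suc k))
      golomb-ruler ∣C∣≢0 with elements-nonempty C ∣C∣≢0
      ... | z , zs , C≡ with ∃-maximum len (arcs z z zs) (≤-trans z<s (≤-reflexive (sym (length-arcs z z zs))))
      ... | (p , q , m) , pqm∈ , len≤m =
        G , m , lift-golomb q , trans (length-map f (elements C)) (length-elements C) ,
        diameter-G≤ , bound
        where
        zs↗ : AllPairs Fin._<_ (z ∷ zs)
        zs↗ = subst (AllPairs Fin._<_) C≡ (elements-sorted C)
        ∣C∣≡ : ∣ C ∣ ≡ length (z ∷ zs)
        ∣C∣≡ = trans (sym (length-elements C)) (cong length C≡)
        f : Fin N → ℤ
        f c = + lift q c
        G = map f (elements C)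
        z≤ : ∀ {c} → c ∈ z ∷ zs → z Fin.≤ c
        z≤ (here refl) = ≤-refl
        z≤ (there c∈)  = <⇒≤ (All.lookup (AllPairs.head zs↗) c∈)
        z⊎zs : ∀ {c} → c ∈ z ∷ zs → c Fin.≤ z ⊎ c ∈ zs
        z⊎zs (here refl) = inj₁ ≤-refl
        z⊎zs (there c∈)  = inj₂ c∈
        -- The discarded arc, of length `m`, ends at `q + N`, one turn after the start of the
        -- window.
        hi : ℤ
        hi = + (toℕ q + N) ℤ.- + m
        ≤hi : ∀ {c} → c ∈ z ∷ zs → f c ℤ.≤ hi
        ≤hi {c} c∈ = subst (ℤ._≤ hi) (i+j-j≡i (f c) (+ m)) (ℤ.+-monoˡ-≤ (ℤ.- + m)
          (ℤ.+≤+ (lift-clears-arc zs↗ pqm∈ (z≤ c∈) (z⊎zs c∈))))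
          where
          i+j-j≡i : ∀ i j → i ℤ.+ j ℤ.- j ≡ i
          i+j-j≡i = ℤ.solve-∀
        hi-q : ∀ i j k → i ℤ.+ j ℤ.- k ℤ.- i ≡ j ℤ.- k
        hi-q = ℤ.solve-∀
        diameter-G≤ : diameter G ℤ.≤ + N ℤ.- + m
        diameter-G≤ rewrite C≡ = subst (diameter (map f (z ∷ zs)) ℤ.≤_) (hi-q (+ toℕ q) (+ N) (+ m))
          (diameter-≤ (All.map⁺ {f = f} (All.tabulate {xs = z ∷ zs} (λ {c} _ → ℤ.+≤+ (q≤lift q c))))
                      (All.map⁺ {f = f} (All.tabulate {xs = z ∷ zs} ≤hi)))
        defects = map (λ x → m ∸ len x) (arcs z z zs)
        sum-lengths : sum (map len (arcs z z zs)) ≡ N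
        sum-lengths = +-cancelʳ-≡ (toℕ z) _ N (trans (sum-arcs z zs↗) (+-comm (toℕ z) N))
        length-defects : length defects ≡ ∣ C ∣
        length-defects = trans (length-map (λ x → m ∸ len x) (arcs z z zs)) (trans (length-arcs z z zs) (sym ∣C∣≡))
        sum-defects : sum defects + N ≡ ∣ C ∣ * m
        sum-defects = begin
          sum defects + N                              ≡⟨ cong (λ s → sum defects + s) sum-lengths ⟨
          sum defects + sum (map len (arcs z z zs))    ≡⟨ sum-deficit len len≤m ⟩
          length (arcs z z zs) * m                     ≡⟨ cong (_* m) (trans (length-arcs z z zs) (sym ∣C∣≡)) ⟩
          ∣ C ∣ * m                                    ∎
          where open ≡-Reasoning
        bound : ∀ k → 2 * (∣ C ∣ * k) + 2 * N ≤ 2 * (∣ C ∣ * m) + g * (k * suc k)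
        bound k = begin
          2 * (∣ C ∣ * k) + 2 * N                         ≡⟨ cong (λ l → 2 * (l * k) + 2 * N) length-defects ⟨
          2 * (length defects * k) + 2 * N                ≤⟨ +-monoˡ-≤ (2 * N) (sum-lower-bound k defects
                                                               (arc-lengths-bounded C≡ len≤m)) ⟩
          2 * sum defects + g * (k * suc k) + 2 * N       ≡⟨ regroup (sum defects) (g * (k * suc k)) N ⟩
          2 * (sum defects + N) + g * (k * suc k)         ≡⟨ cong (λ s → 2 * s + g * (k * suc k)) sum-defects ⟩
          2 * (∣ C ∣ * m) + g * (k * suc k)               ∎
          where
          open ≤-Reasoning
          regroup : ∀ s t N → 2 * s + t + 2 * N ≡ 2 * (s + N) + t
          regroup = solve-∀

-- From an integer inequality to the ceiling in the diameter bound.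

-- The numerator is below the successor of the floor times the denominator; cancelling the positive
-- denominator leaves `m` below that successor.
≤-floor : ∀ m p → m ℤ.* ℚ.↧ p ℤ.≤ ℚ.↥ p → m ℤ.≤ ℚ.floor p
≤-floor m p@record{} h = subst (m ℤ.≤_)
  (trans (ℤ.pred-suc (ℚ.↥ p ℤ./ℕ ℚ.↧ₙ p)) (sym (div-pos-is-/ℕ (ℚ.↥ p) (ℚ.↧ₙ p))))
  (ℤ.i<j⇒i≤pred[j] (ℤ.*-cancelʳ-<-nonNeg {m} {ℤ.suc (ℚ.↥ p ℤ./ℕ ℚ.↧ₙ p)} (ℚ.↧ p)
    (ℤ.≤-<-trans h (n<s[n/ℕd]*d (ℚ.↥ p) (ℚ.↧ₙ p)))))

-- The ceiling of `p` is minus the floor of -p, so negation reduces this to `≤-floor`.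
ceiling-≤ : ∀ p m → toℚᵘ p ℚᵘ.≤ mkℚᵘ m 0 → ceiling p ℤ.≤ m
ceiling-≤ p@record{} m (ℚᵘ.*≤* ↥p≤m*↧p) =
  subst (ceiling p ℤ.≤_) (ℤ.neg-involutive m)
    (ℤ.neg-mono-≤ (≤-floor (ℤ.- m) (ℚ.- p) -m*↧p≤-↥p))
  where
  -m*↧p≤-↥p : ℤ.- m ℤ.* ℚ.↧ (ℚ.- p) ℤ.≤ ℚ.↥ (ℚ.- p)
  -m*↧p≤-↥p = subst₂ ℤ._≤_
    (trans (ℤ.neg-distribˡ-* m (ℚ.↧ p)) (cong (ℤ.- m ℤ.*_) (sym (ℚ.↧-neg p))))
    (trans (cong ℤ.-_ (ℤ.*-identityʳ (ℚ.↥ p))) (sym (ℚ.↥-neg p)))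
    (ℤ.neg-mono-≤ ↥p≤m*↧p)

-- The hypothesis is the comparison of the rational under the ceiling with `m`, cleared of the
-- denominator 2n; as `m` is an integer, it then bounds the ceiling too.
diameterBound-lower : ∀ g n N .{{_ : NonZero n}} a r m →
  + 2 ℤ.* + N ℤ.+ + g ℤ.* a ℤ.* (a ℤ.- 1ℤ) ℤ.+ + 2 ℤ.* (r ℤ.* a) ℤ.≤ + 2 ℤ.* (m ℤ.* + n) →
  + N ℤ.- m ℤ.≤ diameterBound g n N a r
diameterBound-lower g n@(suc n-1) N a r m h =
  ℤ.+-monoʳ-≤ (+ N) (ℤ.neg-mono-≤ (ceiling-≤ _ m (ℚᵘ.≤-trans (ℚᵘ.≤-reflexive unnormalise)
    (ℚᵘ.*≤* (subst₂ ℤ._≤_ (lhs (+ N) x (r ℤ.* a)) (rhs m (+ n)) h)))))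
  where
  x = + g ℤ.* a ℤ.* (a ℤ.- 1ℤ)
  p = + N ℚ./ 1
  q = x ℚ./ 2
  s = (r ℤ.* a) ℚ./ 1
  toℚᵘ-/ : ∀ i d → toℚᵘ (i ℚ./ suc d) ℚᵘ.≃ mkℚᵘ i d
  toℚᵘ-/ i d = ℚ.toℚᵘ-fromℚᵘ (mkℚᵘ i d)
  -- Unnormalised fractions keep numerators and denominators as written, so the comparison becomes a
  -- polynomial one.
  unnormalise : toℚᵘ ((p ℚ.+ q ℚ.+ s) ℚ.* (1ℤ ℚ./ n)) ℚᵘ.≃
    (mkℚᵘ (+ N) 0 ℚᵘ.+ mkℚᵘ x 1 ℚᵘ.+ mkℚᵘ (r ℤ.* a) 0) ℚᵘ.* mkℚᵘ 1ℤ n-1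
  unnormalise = ℚᵘ.≃-trans (ℚ.toℚᵘ-homo-* (p ℚ.+ q ℚ.+ s) (1ℤ ℚ./ n)) (ℚᵘ.*-cong
    (ℚᵘ.≃-trans (ℚ.toℚᵘ-homo-+ (p ℚ.+ q) s) (ℚᵘ.+-cong
      (ℚᵘ.≃-trans (ℚ.toℚᵘ-homo-+ p q) (ℚᵘ.+-cong (toℚᵘ-/ (+ N) 0) (toℚᵘ-/ x 1)))
      (toℚᵘ-/ (r ℤ.* a) 0)))
    (toℚᵘ-/ 1ℤ n-1))
  lhs : ∀ N x y → + 2 ℤ.* N ℤ.+ x ℤ.+ + 2 ℤ.* y ≡
    ((N ℤ.* + 2 ℤ.+ x ℤ.* 1ℤ) ℤ.* 1ℤ ℤ.+ y ℤ.* + 2) ℤ.* 1ℤ ℤ.* 1ℤ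
  lhs = ℤ.solve-∀
  rhs : ∀ m n → + 2 ℤ.* (m ℤ.* n) ≡ m ℤ.* (+ 2 ℤ.* n)
  rhs = ℤ.solve-∀

-- Arithmetic of the quotient and remainder.

-- From n ≥ 0 and r < g, the product ag = n - r exceeds -g, so a exceeds -1.
quotient-nonNeg : ∀ g n a r → + n ≡ a ℤ.* + g ℤ.+ r → r ℤ.< + g → 0ℤ ℤ.≤ a
quotient-nonNeg g n a r n≡ r<g = ℤ.i<j⇒suc[i]≤j (ℤ.*-cancelʳ-<-nonNeg { -1ℤ} {a} (+ g) -g<a*g)
  where
  neg : ∀ g → ℤ.- g ≡ -1ℤ ℤ.* g
  neg = ℤ.solve-∀
  cancel : ∀ x r → x ℤ.+ r ℤ.- r ≡ x
  cancel = ℤ.solve-∀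
  -g<a*g : -1ℤ ℤ.* + g ℤ.< a ℤ.* + g
  -g<a*g = begin-strict
    -1ℤ ℤ.* + g                 ≡⟨ neg (+ g) ⟨
    ℤ.- + g                     <⟨ ℤ.neg-mono-< r<g ⟩
    ℤ.- r                       ≡⟨ ℤ.+-identityˡ (ℤ.- r) ⟨
    0ℤ ℤ.- r                    ≤⟨ ℤ.+-monoˡ-≤ (ℤ.- r) (ℤ.+≤+ z≤n) ⟩
    + n ℤ.- r                   ≡⟨ cong (ℤ._- r) n≡ ⟩
    a ℤ.* + g ℤ.+ r ℤ.- r       ≡⟨ cancel (a ℤ.* + g) r ⟩
    a ℤ.* + g                   ∎
    where open ℤ.≤-Reasoning

-- Subtract `T`, which is gk(k + 1), and substitute n = kg + r: then 2nk - gk(k + 1) = gk(k - 1) +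
-- 2rk, twice the correction term in the numerator of the diameter bound.
quadratic-bound : ∀ {g n N m} k r → n ≡ k * g + r →
  2 * (n * k) + 2 * N ≤ 2 * (n * m) + g * (k * suc k) →
  + 2 ℤ.* + N ℤ.+ + g ℤ.* + k ℤ.* (+ k ℤ.- 1ℤ) ℤ.+ + 2 ℤ.* (+ r ℤ.* + k) ℤ.≤ + 2 ℤ.* (+ m ℤ.* + n)
quadratic-bound {g} {n} {N} {m} k r n≡ h = subst₂ ℤ._≤_ lhs rhs (ℤ.+-monoˡ-≤ (ℤ.- T) (subst₂ ℤ._≤_ castˡ castʳ (ℤ.+≤+ h)))
  where
  T = + g ℤ.* (+ k ℤ.* (1ℤ ℤ.+ + k))
  pos-*-* : ∀ x y z → + (x * (y * z)) ≡ + x ℤ.* (+ y ℤ.* + z)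
  pos-*-* x y z = trans (ℤ.pos-* x (y * z)) (cong (λ i → + x ℤ.* i) (ℤ.pos-* y z))
  castˡ : + (2 * (n * k) + 2 * N) ≡ + 2 ℤ.* (+ n ℤ.* + k) ℤ.+ + 2 ℤ.* + N
  castˡ = cong₂ ℤ._+_ (pos-*-* 2 n k) (ℤ.pos-* 2 N)
  castʳ : + (2 * (n * m) + g * (k * suc k)) ≡ + 2 ℤ.* (+ n ℤ.* + m) ℤ.+ T
  castʳ = cong₂ ℤ._+_ (pos-*-* 2 n m) (pos-*-* g k (suc k))
  +n≡ : + n ≡ + k ℤ.* + g ℤ.+ + r
  +n≡ = trans (cong +_ n≡) (cong (ℤ._+ + r) (ℤ.pos-* k g))
  lhs : + 2 ℤ.* (+ n ℤ.* + k) ℤ.+ + 2 ℤ.* + N ℤ.- T ≡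
    + 2 ℤ.* + N ℤ.+ + g ℤ.* + k ℤ.* (+ k ℤ.- 1ℤ) ℤ.+ + 2 ℤ.* (+ r ℤ.* + k)
  lhs = trans (cong (λ i → + 2 ℤ.* (i ℤ.* + k) ℤ.+ + 2 ℤ.* + N ℤ.- T) +n≡) (eq (+ g) (+ k) (+ N) (+ r))
    where
    eq : ∀ g k N r → + 2 ℤ.* ((k ℤ.* g ℤ.+ r) ℤ.* k) ℤ.+ + 2 ℤ.* N ℤ.- g ℤ.* (k ℤ.* (1ℤ ℤ.+ k)) ≡
      + 2 ℤ.* N ℤ.+ g ℤ.* k ℤ.* (k ℤ.- 1ℤ) ℤ.+ + 2 ℤ.* (r ℤ.* k)
    eq = ℤ.solve-∀
  rhs : + 2 ℤ.* (+ n ℤ.* + m) ℤ.+ T ℤ.- T ≡ + 2 ℤ.* (+ m ℤ.* + n)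
  rhs = eq (+ n) (+ m) T
    where
    eq : ∀ n m T → + 2 ℤ.* (n ℤ.* m) ℤ.+ T ℤ.- T ≡ + 2 ℤ.* (m ℤ.* n)
    eq = ℤ.solve-∀

lemma2 : ∀ (g n N : ℕ) .{{_ : NonZero g}} .{{_ : NonZero n}} .{{_ : NonZero N}} →
    (C : Subset N) → IsModularGolombRuler N g C → ∣ C ∣ ≡ n →
    (a r : ℤ) → + n ≡ a ℤ.* + g ℤ.+ r → 0ℤ ℤ.≤ r → r ℤ.< + g →
    (∃[ G ] IsGolombRuler g G × length G ≡ n ×
    diameter G ℤ.≤ diameterBound g n N a r)
    ×
    (∀ (g′ : ℕ) → g ℕ.≤ g′ →
    ∃[ G ] IsGolombRuler g′ G × length G ≡ n ×
    diameter G ℤ.≤ diameterBound g n N a r)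
lemma2 g n N C golomb refl a r n≡ (ℤ.+≤+ {n = j} _) r<g
  -- Nonnegativity turns the integer `a` into a natural `k`, at which the family of inequalities is
  -- evaluated.
  with quotient-nonNeg g n a r n≡ r<g
... | ℤ.+≤+ {n = k} _ with golomb-ruler golomb (≢-nonZero⁻¹ n)
... | G , m , (G! , count≤g) , ∣G∣≡n , diameter≤ , bound =
  (G , (G! , count≤g) , ∣G∣≡n , diameter≤bound) ,
  -- The same ruler serves every larger multiplicity, since its difference counts are already at
  -- most `g`.
  λ g′ g≤g′ → G , (G! , λ d 0<d → ≤-trans (count≤g d 0<d) g≤g′) , ∣G∣≡n , diameter≤bound
  where
  n≡kg+j : n ≡ k * g + j
  n≡kg+j = ℤ.+-injective (trans n≡ (cong (ℤ._+ + j) (sym (ℤ.pos-* k g))))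
  diameter≤bound : diameter G ℤ.≤ diameterBound g n N a r
  diameter≤bound = ℤ.≤-trans diameter≤
    (diameterBound-lower g n N (+ k) (+ j) (+ m) (quadratic-bound {g} {n} {N} {m} k j n≡kg+j (bound k)))
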